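{- For all integers $n\geq 0$, $p^{\mathrm{eu}}_{\mathrm{od}}(n)\leq p^{\mathrm{ou}}_{\mathrm{ed}}(n)$. Moreover, $p^{\mathrm{eu}}_{\mathrm{od}}(n)< p^{\mathrm{ou}}_{\mathrm{ed}}(n)$ for all $n\geq 5$.
   Context: A partition of a non-negative integer $n$ is a non-increasing (finite, possibly empty) sequence of positive integers, called parts, summing to $n$. $p^{\mathrm{eu}}_{\mathrm{od}}(n)$ is the number of partitions of $n$ in which every even part is larger than every odd part, the odd parts are pairwise distinct, and the even parts are unrestricted (may be repeated). $p^{\mathrm{ou}}_{\mathrm{ed}}(n)$ is the number of partitions of $n$ in which every odd part is larger than every even part, the even parts are pairwise distinct, and the odd parts are unrestricted (may be repeated). In both cases partitions with no even parts or with no odd parts are allowed. -}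

module Defs where

open import Data.Empty using (⊥-elim)
open import Data.List using (List; []; _∷_; _++_; filter; length; map)
open import Data.List.Membership.Propositional using (_∈_)
open import Data.List.Membership.Propositional.Properties using (∈-++⁺ˡ; ∈-++⁺ʳ; ∈-++⁻; ∈-map⁺; ∈-map⁻)
open import Data.List.Relation.Unary.All using (All; []; _∷_; all?)
open import Data.List.Relation.Unary.AllPairs using ([]; _∷_)
open import Data.List.Relation.Unary.Any using (here; there)
open import Data.List.Relation.Unary.Linked using (Linked; []; [-]; _∷_)
open import Data.List.Relation.Unary.Unique.Propositional using (Unique)
import Data.List.Relation.Unary.Unique.Propositional.Properties as Unique
open import Data.List.Properties using (∷-injectiveʳ)
open import Data.Nat using (ℕ; zero; suc; _+_; _∸_; _≤_; _<_; _≥_; _≤?_; _<?_; z≤n; s≤s)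
open import Data.Nat.Divisibility using (_∣_; _∣?_)
open import Data.Nat.ListAction using (sum)
open import Data.Nat.Properties
open import Data.List.Relation.Unary.Unique.DecPropositional _≟_ using (unique?)
open import Data.Product using (_×_; _,_)
open import Data.Sum using (inj₁; inj₂)
open import Function using (_⇔_; mk⇔)
open import Relation.Binary.PropositionalEquality using (_≡_; refl; sym; trans; cong; subst)
open import Relation.Nullary using (Dec; ¬_; yes; no; ¬?)
open import Relation.Nullary.Decidable using (_×-dec_)
open import Relation.Unary using (Decidable)

IsPartition : ℕ → List ℕ → Set
IsPartition n xs = Linked _≥_ xs × All (0 <_) xs × sum xs ≡ n

Even Odd : ℕ → Set
Even k = 2 ∣ k
Odd  k = ¬ (2 ∣ k)

even? : Decidable Even
even? k = 2 ∣? k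

odd? : Decidable Odd
odd? k = ¬? (2 ∣? k)

evens odds : List ℕ → List ℕ
evens = filter even?
odds  = filter odd?

AllAbove : List ℕ → List ℕ → Set
AllAbove xs ys = All (λ x → All (λ y → y < x) ys) xs

allAbove? : ∀ xs ys → Dec (AllAbove xs ys)
allAbove? xs ys = all? (λ x → all? (λ y → y <? x) ys) xs

EuOd OuEd : List ℕ → Set
EuOd xs = AllAbove (evens xs) (odds xs) × Unique (odds xs)
OuEd xs = AllAbove (odds xs) (evens xs) × Unique (evens xs)

euOd? : Decidable EuOd
euOd? xs = allAbove? (evens xs) (odds xs) ×-dec unique? (odds xs)

ouEd? : Decidable OuEd
ouEd? xs = allAbove? (odds xs) (evens xs) ×-dec unique? (evens xs)

-- boundedPartitions l m n lists the partitions of n into at most l parts,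
-- each at most m.  In the last clause the largest part is either at most m
-- or equal to suc m; the latter leaves suc n ∸ suc m = n ∸ m.
boundedPartitions : ℕ → ℕ → ℕ → List (List ℕ)
boundedPartitions l       m       zero    = [] ∷ []
boundedPartitions zero    m       (suc n) = []
boundedPartitions (suc l) zero    (suc n) = []
boundedPartitions (suc l) (suc m) (suc n) with m ≤? n
... | yes _ = boundedPartitions (suc l) m (suc n)
              ++ map (suc m ∷_) (boundedPartitions l (suc m) (n ∸ m))
... | no  _ = boundedPartitions (suc l) m (suc n)

-- A partition of n has at most n parts, each at most n; that this list
-- contains every partition of n exactly once is ∈-partitions and
-- partitions-unique below.
partitions : ℕ → List (List ℕ)
partitions n = boundedPartitions n n n

p-eu-od p-ou-ed : ℕ → ℕ
p-eu-od n = length (filter euOd? (partitions n))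
p-ou-ed n = length (filter ouEd? (partitions n))

private
  Linked-∷ : ∀ {x xs} → All (_≤ x) xs → Linked _≥_ xs → Linked _≥_ (x ∷ xs)
  Linked-∷ []      []         = [-]
  Linked-∷ (p ∷ _) [-]        = p ∷ [-]
  Linked-∷ (p ∷ _) l@(_ ∷ _)  = p ∷ l

  Linked-tail : ∀ {x xs} → Linked _≥_ (x ∷ xs) → Linked _≥_ xs
  Linked-tail [-]     = []
  Linked-tail (_ ∷ l) = l

  Linked-bound : ∀ {x m xs} → x ≤ m → Linked _≥_ (x ∷ xs) → All (_≤ m) (x ∷ xs)
  Linked-bound x≤m [-]       = x≤m ∷ []
  Linked-bound x≤m (y≤x ∷ l) = x≤m ∷ Linked-bound (≤-trans y≤x x≤m) l

  weaken : ∀ {m xs} → All (_≤ m) xs → All (_≤ suc m) xs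
  weaken []       = []
  weaken (p ∷ ps) = m≤n⇒m≤1+n p ∷ weaken ps

  length≤sum : ∀ {xs} → All (0 <_) xs → length xs ≤ sum xs
  length≤sum []       = z≤n
  length≤sum (p ∷ ps) = +-mono-≤ p (length≤sum ps)

  parts≤sum : ∀ xs → All (_≤ sum xs) xs
  parts≤sum []       = []
  parts≤sum (x ∷ xs) = m≤m+n x (sum xs) ∷ go (parts≤sum xs)
    where
    go : ∀ {ys} → All (_≤ sum xs) ys → All (_≤ x + sum xs) ys
    go []       = []
    go (p ∷ ps) = ≤-trans p (m≤n+m (sum xs) x) ∷ go ps

∈-boundedPartitions⁻ : ∀ l m n {xs} → xs ∈ boundedPartitions l m n →
                       IsPartition n xs × All (_≤ m) xs
∈-boundedPartitions⁻ l       m       zero    (here refl) = ([] , [] , refl) , []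
∈-boundedPartitions⁻ (suc l) (suc m) (suc n) xs∈ with m ≤? n
... | no  _ with ∈-boundedPartitions⁻ (suc l) m (suc n) xs∈
...   | isP , bnd = isP , weaken bnd
∈-boundedPartitions⁻ (suc l) (suc m) (suc n) xs∈
    | yes m≤n with ∈-++⁻ (boundedPartitions (suc l) m (suc n)) xs∈
...   | inj₁ xs∈₁ with ∈-boundedPartitions⁻ (suc l) m (suc n) xs∈₁
...     | isP , bnd = isP , weaken bnd
∈-boundedPartitions⁻ (suc l) (suc m) (suc n) xs∈
    | yes m≤n | inj₂ xs∈₂ with ∈-map⁻ (suc m ∷_) xs∈₂
...     | ys , ys∈ , refl with ∈-boundedPartitions⁻ l (suc m) (n ∸ m) ys∈
...       | (lnk , pos , sm) , bnd =
            ( Linked-∷ bnd lnk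
            , s≤s z≤n ∷ pos
            , cong suc (trans (cong (m +_) sm) (m+[n∸m]≡n m≤n)) )
            , ≤-refl ∷ bnd

∈-boundedPartitions⁺ : ∀ l m n {xs} → IsPartition n xs → All (_≤ m) xs →
                       length xs ≤ l → xs ∈ boundedPartitions l m n
∈-boundedPartitions⁺ l m zero {[]} _ _ _ = here refl
∈-boundedPartitions⁺ l m zero {suc x ∷ xs} (_ , _ , ()) _ _
∈-boundedPartitions⁺ l m zero {zero ∷ xs} (_ , () ∷ _ , _) _ _
∈-boundedPartitions⁺ zero m (suc n) {[]} (_ , _ , ()) _ _
∈-boundedPartitions⁺ (suc l) zero (suc n) {[]} (_ , _ , ()) _ _
∈-boundedPartitions⁺ (suc l) zero (suc n) {zero ∷ xs} (_ , () ∷ _ , _) _ _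
∈-boundedPartitions⁺ (suc l) zero (suc n) {suc x ∷ xs} _ (() ∷ _) _
∈-boundedPartitions⁺ (suc l) (suc m) (suc n) {[]} (_ , _ , ()) _ _
∈-boundedPartitions⁺ (suc l) (suc m) (suc n) {zero ∷ xs} (_ , () ∷ _ , _) _ _
∈-boundedPartitions⁺ (suc l) (suc m) (suc n) {suc x ∷ xs}
                     isP@(lnk , _ ∷ pos , sm) (s≤s x≤m ∷ bnd) (s≤s len)
  with m ≤? n | x ≟ m
... | no _ | no x≢m =
  ∈-boundedPartitions⁺ (suc l) m (suc n) isP
    (Linked-bound (≤∧≢⇒< x≤m x≢m) lnk) (s≤s len)
... | yes _ | no x≢m =
  ∈-++⁺ˡ (∈-boundedPartitions⁺ (suc l) m (suc n) isP
    (Linked-bound (≤∧≢⇒< x≤m x≢m) lnk) (s≤s len))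
... | no m≰n | yes refl =
  ⊥-elim (m≰n (subst (m ≤_) (suc-injective sm) (m≤m+n m (sum xs))))
... | yes m≤n | yes refl =
  ∈-++⁺ʳ (boundedPartitions (suc l) m (suc n)) (∈-map⁺ (suc m ∷_)
    (∈-boundedPartitions⁺ l (suc m) (n ∸ m)
      ( Linked-tail lnk , pos
      , trans (sym (m+n∸m≡n m (sum xs))) (cong (_∸ m) (suc-injective sm)) )
      bnd len))

∈-partitions : ∀ n xs → xs ∈ partitions n ⇔ IsPartition n xs
∈-partitions n xs = mk⇔ to from
  where
  to : xs ∈ partitions n → IsPartition n xs
  to xs∈ with ∈-boundedPartitions⁻ n n n xs∈
  ... | isP , _ = isP

  from : IsPartition n xs → xs ∈ partitions n
  from isP@(_ , pos , refl) =
    ∈-boundedPartitions⁺ n n n isP (parts≤sum xs) (length≤sum pos)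

boundedPartitions-unique : ∀ l m n → Unique (boundedPartitions l m n)
boundedPartitions-unique l       m       zero    = [] ∷ []
boundedPartitions-unique zero    m       (suc n) = []
boundedPartitions-unique (suc l) zero    (suc n) = []
boundedPartitions-unique (suc l) (suc m) (suc n) with m ≤? n
... | no  _ = boundedPartitions-unique (suc l) m (suc n)
... | yes _ = Unique.++⁺ (boundedPartitions-unique (suc l) m (suc n))
                (Unique.map⁺ ∷-injectiveʳ
                  (boundedPartitions-unique l (suc m) (n ∸ m)))
                disjoint
  where
  disjoint : ∀ {xs} → ¬ (xs ∈ boundedPartitions (suc l) m (suc n)
                       × xs ∈ map (suc m ∷_) (boundedPartitions l (suc m) (n ∸ m)))
  disjoint (xs∈₁ , xs∈₂) with ∈-map⁻ (suc m ∷_) xs∈₂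
  ... | _ , _ , refl with ∈-boundedPartitions⁻ (suc l) m (suc n) xs∈₁
  ...   | _ , 1+m≤m ∷ _ = 1+n≰n 1+m≤m

partitions-unique : ∀ n → Unique (partitions n)
partitions-unique n = boundedPartitions-unique n n n

{-# OPTIONS --safe #-}

-- The inequality is an injection on partitions of n.  Let a partition of the
-- first kind have even parts e₁ ≥ … ≥ eₘ above odd parts o₁ > … > oₖ.
--   * If k < 2 or oₖ > 1, split every eⱼ into eⱼ − 1 and 1.  There are 2m + k parts,
--     at least m of them ones, and exactly m if k ≥ 2; this determines k and m.
--   * If oₖ = 1, k ≥ 2 and m + k is even, decrease every part by 1 (so that oₖ
--     disappears) and add m + k to the largest part.
--   * If oₖ = 1, k ≥ 3 and m + k is odd, do the same but keep o₁, and add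
--     m + k − 1 to the largest part.
--   * If k = 2, o₂ = 1 and m is odd, the image is e₁ + 2, e₂, …, eₘ, o₁ − 1 when
--     e₂ > … > eₘ > o₁ + 1, and otherwise e₁ + m, e₂ − 1, …, eₘ − 1, o₁, which has
--     a repeated part and no ones, unlike the images of the first case.
-- For n ≥ 5 one of 2j+1, 2j;  2j+2, 2j;  2j+3, 2j;  2j+1, 2j+1, 2 (with j ≥ 1) is a
-- partition of n of the second kind, and these are never hit.

module Submission where

open import Defs
open import Data.Nat using (ℕ; zero; suc; _+_; _∸_; _≤_; _<_; _≥_; _>_; z≤n; s≤s; s≤s⁻¹; _>?_)
open import Data.Nat.Properties
open import Data.Nat.Divisibility using (_∣_; divides; ∣m+n∣m⇒∣n; ∣1⇒≡1)
open import Data.Nat.ListAction using (sum)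
open import Data.Nat.ListAction.Properties using (sum-++)
open import Data.Nat.Tactic.RingSolver using (solve-∀)
open import Data.Empty using (⊥; ⊥-elim)
open import Data.List using (List; []; _∷_; [_]; _++_; filter; length; map; replicate)
open import Data.List.Membership.Propositional using (_∈_)
open import Data.List.Membership.Propositional.Properties
  using (∈-∃++; ∈-++⁺ˡ; ∈-++⁺ʳ; ∈-++⁻; ∈-filter⁺; ∈-filter⁻)
open import Data.List.Properties
  using (map-++; map-injective; length-++; length-++-sucʳ; length-replicate;
         ++-identityʳ; ++-assoc; ++-cancelʳ; ∷-injective; ∷-injectiveˡ; ∷-injectiveʳ;
         ∷ʳ-injective; filter-++; filter-all; filter-none)
open import Data.List.Relation.Unary.All as All using (All; []; _∷_)
import Data.List.Relation.Unary.All.Properties as All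
open import Data.List.Relation.Unary.AllPairs as AllPairs using (AllPairs; []; _∷_; allPairs?)
import Data.List.Relation.Unary.AllPairs.Properties as AllPairs
open import Data.List.Relation.Unary.Any using (here; there)
open import Data.List.Relation.Unary.Linked.Properties using (Linked⇒AllPairs; AllPairs⇒Linked)
open import Data.List.Relation.Unary.Unique.Propositional using (Unique)
import Data.List.Relation.Unary.Unique.Propositional.Properties as Unique
open import Data.Product using (_×_; ∃₂; ∃-syntax; _,_)
open import Data.Sum using (_⊎_; inj₁; inj₂)
open import Function using (_∘_; Equivalence)
open import Relation.Binary.Definitions using (tri<; tri≈; tri>)
open import Relation.Binary.PropositionalEquality
  using (_≡_; _≢_; refl; sym; trans; cong; cong₂; subst; subst₂; module ≡-Reasoning)
open import Relation.Nullary using (¬_; yes; no)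

private variable
  A B : Set
  n : ℕ
  W W′ O O′ G G′ Z Z′ : List ℕ

-- List lemmas and comparison of lengths along an injective relation.

AllPairs-++⁻ : {R : A → A → Set} (xs : List A) {ys : List A} → AllPairs R (xs ++ ys) →
               AllPairs R xs × AllPairs R ys × All (λ x → All (R x) ys) xs
AllPairs-++⁻ []       rs       = [] , rs , []
AllPairs-++⁻ (x ∷ xs) (r ∷ rs) with AllPairs-++⁻ xs rs | All.++⁻ xs r
... | p , q , c | p₀ , c₀ = p₀ ∷ p , q , c₀ ∷ c

++-injective-length : (xs : List A) {xs′ ys ys′ : List A} → length xs ≡ length xs′ →
                      xs ++ ys ≡ xs′ ++ ys′ → xs ≡ xs′ × ys ≡ ys′
++-injective-length []       {[]}      _ eq = refl , eq
++-injective-length (x ∷ xs) {x′ ∷ xs′} l eq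
  with refl , eq′ ← ∷-injective eq
  with xs≡ , ys≡ ← ++-injective-length xs (suc-injective l) eq′ = cong (x ∷_) xs≡ , ys≡

replicate-+ : ∀ m n {x : A} → replicate (m + n) x ≡ replicate m x ++ replicate n x
replicate-+ zero    n = refl
replicate-+ (suc m) n = cong (_ ∷_) (replicate-+ m n)

∈-remove : {ys : List A} {y : A} → y ∈ ys →
           ∃[ zs ] length ys ≡ suc (length zs) × (∀ {z} → z ∈ ys → z ≢ y → z ∈ zs)
∈-remove {y = y} y∈ with as , bs , refl ← ∈-∃++ y∈ = as ++ bs , length-++-sucʳ as y bs , keep
  where
  keep : ∀ {z} → z ∈ as ++ y ∷ bs → z ≢ y → z ∈ as ++ bs
  keep z∈ z≢y with ∈-++⁻ as z∈
  ... | inj₁ z∈as         = ∈-++⁺ˡ z∈as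
  ... | inj₂ (here z≡y)   = ⊥-elim (z≢y z≡y)
  ... | inj₂ (there z∈bs) = ∈-++⁺ʳ as z∈bs

module _ {R : A → B → Set} (R-inj : ∀ {x x′ y} → R x y → R x′ y → x ≡ x′) where

  -- Pigeonhole by induction on `xs`: the partner of the head is deleted from `ys`. By `R-inj` and
  -- uniqueness, every later element has a different partner, so that partner survives the deletion.
  -- Working with a relation allows the injection to be given by rules.
  length-≤ : ∀ {xs ys} → Unique xs → (∀ {x} → x ∈ xs → ∃[ y ] y ∈ ys × R x y) →
             length xs ≤ length ys
  length-≤ {[]}     _        _   = z≤n
  length-≤ {x ∷ xs} (x∉ ∷ u) hit with y , y∈ , Rxy ← hit (here refl)
    with zs , eq , keep ← ∈-remove y∈ =
    subst (suc (length xs) ≤_) (sym eq) (s≤s (length-≤ u hit′))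
    where
    hit′ : ∀ {x′} → x′ ∈ xs → ∃[ y′ ] y′ ∈ zs × R x′ y′
    hit′ x′∈ with y′ , y′∈ , Rx′y′ ← hit (there x′∈) =
      y′ , keep y′∈ (λ { refl → All.lookup x∉ x′∈ (R-inj Rxy Rx′y′) }) , Rx′y′

  -- Deleting the missed value `y₀` first loses no partner, so `length-≤` applies to a list shorter
  -- by one.
  length-< : ∀ {xs ys y₀} → Unique xs → (∀ {x} → x ∈ xs → ∃[ y ] y ∈ ys × R x y) →
             y₀ ∈ ys → (∀ {x} → ¬ R x y₀) → length xs < length ys
  length-< {xs} u hit y₀∈ miss with zs , eq , keep ← ∈-remove y₀∈ =
    subst (length xs <_) (sym eq) (s≤s (length-≤ u λ x∈ →
      let y , y∈ , Rxy = hit x∈ in y , keep y∈ (λ { refl → miss Rxy }) , Rxy))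

-- Halving and doubling.

half : ∀ n → (∃[ h ] n ≡ h + h) ⊎ (∃[ h ] n ≡ suc (h + h))
half zero    = inj₁ (0 , refl)
half (suc n) with half n
... | inj₁ (h , refl) = inj₂ (h , refl)
... | inj₂ (h , refl) = inj₁ (suc h , cong suc (sym (+-suc h h)))

double-≤⁻ : ∀ {a b} → a + a ≤ b + b → a ≤ b
double-≤⁻ le = ≮⇒≥ λ b<a → <⇒≱ (+-mono-< b<a b<a) le

double-injective : ∀ {a b} → a + a ≡ b + b → a ≡ b
double-injective eq = ≤-antisym (double-≤⁻ (≤-reflexive eq)) (double-≤⁻ (≤-reflexive (sym eq)))

double≢suc-double : ∀ a b → a + a ≢ suc (b + b)
double≢suc-double zero    b       ()
double≢suc-double (suc a) zero    eq rewrite +-suc a a with () ← eq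
double≢suc-double (suc a) (suc b) eq rewrite +-suc a a | +-suc b b =
  double≢suc-double a b (suc-injective (suc-injective eq))

-- Positive parts coded by half their size.

ev od : ℕ → ℕ
ev w = suc (suc (w + w))
od y = suc (y + y)

2∣double : ∀ h → 2 ∣ h + h
2∣double h = divides h (trans (cong (h +_) (sym (+-identityʳ h))) (*-comm 2 h))

ev-even : ∀ w → Even (ev w)
ev-even w = subst (2 ∣_) (cong suc (+-suc w w)) (2∣double (suc w))

od-odd : ∀ y → Odd (od y)
od-odd y 2∣ with () ← ∣1⇒≡1 (∣m+n∣m⇒∣n (subst (2 ∣_) (+-comm 1 (y + y)) 2∣) (2∣double y))

data Code : ℕ → Set where
  even : ∀ w → Code (ev w)
  odd  : ∀ y → Code (od y)

code : ∀ {x} → 0 < x → Code x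
code {suc n} _ with half n
... | inj₁ (h , refl) = odd h
... | inj₂ (h , refl) = even h

ev-injective : ∀ {w w′} → ev w ≡ ev w′ → w ≡ w′
ev-injective eq = double-injective (suc-injective (suc-injective eq))

od-injective : ∀ {y y′} → od y ≡ od y′ → y ≡ y′
od-injective eq = double-injective (suc-injective eq)

od<ev⁻ : ∀ {y w} → od y < ev w → y ≤ w
od<ev⁻ (s≤s (s≤s p)) = double-≤⁻ p

ev<od⁺ : ∀ {z g} → z < g → ev z < od g
ev<od⁺ {z} {g} p = s≤s (subst (_≤ g + g) (cong suc (+-suc z z)) (+-mono-≤ p p))

ev-mono-≤ : ∀ {w w′} → w ≤ w′ → ev w ≤ ev w′
ev-mono-≤ p = s≤s (s≤s (+-mono-≤ p p))

od-mono-≤ : ∀ {y y′} → y ≤ y′ → od y ≤ od y′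
od-mono-≤ p = s≤s (+-mono-≤ p p)

-- A partition is coded by two lists: even parts ev w = 2w + 2 and odd parts
-- od y = 2y + 1, so that the decrement ev w ↦ od w is the identity on codes.

euOdParts ouEdParts : List ℕ → List ℕ → List ℕ
euOdParts W O = map ev W ++ map od O
ouEdParts G Z = map od G ++ map ev Z

evens-ev : ∀ W → evens (map ev W) ≡ map ev W
evens-ev W = filter-all even? (All.map⁺ (All.universal ev-even W))

odds-od : ∀ O → odds (map od O) ≡ map od O
odds-od O = filter-all odd? (All.map⁺ (All.universal od-odd O))

evens-od : ∀ O → evens (map od O) ≡ []
evens-od O = filter-none even? (All.map⁺ (All.universal od-odd O))

odds-ev : ∀ W → odds (map ev W) ≡ []
odds-ev W = filter-none odd? (All.map⁺ (All.universal (λ w ¬e → ¬e (ev-even w)) W))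

evens-euOdParts : ∀ W O → evens (euOdParts W O) ≡ map ev W
evens-euOdParts W O = trans (filter-++ even? (map ev W) (map od O))
  (trans (cong₂ _++_ (evens-ev W) (evens-od O)) (++-identityʳ _))

odds-euOdParts : ∀ W O → odds (euOdParts W O) ≡ map od O
odds-euOdParts W O = trans (filter-++ odd? (map ev W) (map od O)) (cong₂ _++_ (odds-ev W) (odds-od O))

evens-ouEdParts : ∀ G Z → evens (ouEdParts G Z) ≡ map ev Z
evens-ouEdParts G Z = trans (filter-++ even? (map od G) (map ev Z)) (cong₂ _++_ (evens-od G) (evens-ev Z))

odds-ouEdParts : ∀ G Z → odds (ouEdParts G Z) ≡ map od G
odds-ouEdParts G Z = trans (filter-++ odd? (map od G) (map ev Z))
  (trans (cong₂ _++_ (odds-od G) (odds-ev Z)) (++-identityʳ _))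

ouEdParts-injective : ∀ G Z G′ Z′ → ouEdParts G Z ≡ ouEdParts G′ Z′ → G ≡ G′ × Z ≡ Z′
ouEdParts-injective G Z G′ Z′ eq =
    map-injective od-injective
      (trans (sym (odds-ouEdParts G Z)) (trans (cong odds eq) (odds-ouEdParts G′ Z′)))
  , map-injective ev-injective
      (trans (sym (evens-ouEdParts G Z)) (trans (cong evens eq) (evens-ouEdParts G′ Z′)))

-- Partitions of the two kinds as pairs of code lists.

record EuOdCode (W O : List ℕ) : Set where
  constructor euOd
  field
    W-decreasing : AllPairs _≥_ W
    O-decreasing : AllPairs _>_ O
    O≤W          : All (λ w → All (_≤ w) O) W

-- Here the bound between the lists is strict, because 2z + 2 < 2g + 1 means z < g. In `EuOdCode` it
-- is weak, because 2y + 1 < 2w + 2 means y ≤ w.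
record OuEdCode (G Z : List ℕ) : Set where
  constructor ouEd
  field
    G-decreasing : AllPairs _≥_ G
    Z-decreasing : AllPairs _>_ Z
    Z<G          : All (λ g → All (_< g) Z) G

open EuOdCode
open OuEdCode

all-odd : ∀ {xs} → All (0 <_) xs → (∀ {x} → x ∈ xs → Odd x) → ∃[ O ] xs ≡ map od O
all-odd []       _   = [] , refl
all-odd (p ∷ ps) odd∈ with code p | all-odd ps (odd∈ ∘ there)
... | even w | _        = ⊥-elim (odd∈ (here refl) (ev-even w))
... | odd y  | O , refl = y ∷ O , refl

-- Once an odd part occurs, no even part can follow: it would have to exceed that odd part, against
-- the order of the list.
evens-then-odds : ∀ {xs} → AllPairs _≥_ xs → All (0 <_) xs →
                  (∀ {x y} → x ∈ xs → y ∈ xs → Even x → Odd y → y < x) →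
                  ∃₂ λ W O → xs ≡ euOdParts W O
evens-then-odds []       []       _     = [] , [] , refl
evens-then-odds (r ∷ rs) (p ∷ ps) above with code p
... | even w with W , O , refl ← evens-then-odds rs ps (λ x∈ y∈ → above (there x∈) (there y∈)) =
  w ∷ W , O , refl
... | odd y  with O , refl ← all-odd ps (λ x∈ 2∣x →
                    <⇒≱ (above (there x∈) (here refl) 2∣x (od-odd y)) (All.lookup r x∈)) =
  [] , y ∷ O , refl

≥-trans : ∀ {a b c} → a ≥ b → b ≥ c → a ≥ c
≥-trans p q = ≤-trans q p

euOd-code : ∀ {xs} → IsPartition n xs → EuOd xs →
            ∃₂ λ W O → EuOdCode W O × xs ≡ euOdParts W O × sum (euOdParts W O) ≡ n
euOd-code {xs = xs} (linked , pos , sum≡) (above , distinct)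
  with sorted ← Linked⇒AllPairs ≥-trans linked
  with W , O , refl ← evens-then-odds sorted pos (λ x∈ y∈ ex oy →
         All.lookup (All.lookup above (∈-filter⁺ even? x∈ ex)) (∈-filter⁺ odd? y∈ oy)) =
  W , O , euOd
    (AllPairs.map (double-≤⁻ ∘ s≤s⁻¹ ∘ s≤s⁻¹) (AllPairs.map⁻ evs))
    (AllPairs.map (λ (p , q) → ≤∧≢⇒< (double-≤⁻ (s≤s⁻¹ p)) (q ∘ cong od ∘ sym))
      (AllPairs.zip (AllPairs.map⁻ ods , AllPairs.map⁻ dist)))
    (All.map (λ p → All.map od<ev⁻ (All.map⁻ p)) (All.map⁻ abv))
  , refl , sum≡
  where
  evs  = subst (AllPairs _≥_) (evens-euOdParts W O) (AllPairs.filter⁺ even? sorted)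
  ods  = subst (AllPairs _≥_) (odds-euOdParts W O) (AllPairs.filter⁺ odd? sorted)
  dist = subst Unique (odds-euOdParts W O) distinct
  abv  = subst₂ AllAbove (evens-euOdParts W O) (odds-euOdParts W O) above

ouEd-partition : OuEdCode G Z → sum (ouEdParts G Z) ≡ n →
                 IsPartition n (ouEdParts G Z) × OuEd (ouEdParts G Z)
ouEd-partition {G} {Z} c sum≡ =
    ( AllPairs⇒Linked (AllPairs.++⁺
        (AllPairs.map⁺ (AllPairs.map od-mono-≤ (G-decreasing c)))
        (AllPairs.map⁺ (AllPairs.map (ev-mono-≤ ∘ <⇒≤) (Z-decreasing c)))
        (All.map (All.map <⇒≤) above))
    , All.++⁺ (All.map⁺ (All.universal (λ _ → s≤s z≤n) G)) (All.map⁺ (All.universal (λ _ → s≤s z≤n) Z))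
    , sum≡ )
  , subst₂ AllAbove (sym (odds-ouEdParts G Z)) (sym (evens-ouEdParts G Z)) above
  , subst Unique (sym (evens-ouEdParts G Z))
      (AllPairs.map⁺ (AllPairs.map (λ p eq → <⇒≢ p (sym (ev-injective eq))) (Z-decreasing c)))
  where
  above : AllAbove (map od G) (map ev Z)
  above = All.map⁺ (All.map (λ p → All.map⁺ (All.map ev<od⁺ p)) (Z<G c))

-- Weights of coded parts.

evSum odSum : List ℕ → ℕ
evSum xs = sum (map ev xs)
odSum xs = sum (map od xs)

evSum-++ : ∀ xs ys → evSum (xs ++ ys) ≡ evSum xs + evSum ys
evSum-++ xs ys = trans (cong sum (map-++ ev xs ys)) (sum-++ (map ev xs) (map ev ys))

odSum-++ : ∀ xs ys → odSum (xs ++ ys) ≡ odSum xs + odSum ys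
odSum-++ xs ys = trans (cong sum (map-++ od xs ys)) (sum-++ (map od xs) (map od ys))

-- Passing from `ev x` to `od x` costs one unit per part. This accounts for the weight in every rule
-- that turns even parts into odd ones.
evSum-odSum : ∀ xs → evSum xs ≡ odSum xs + length xs
evSum-odSum []       = refl
evSum-odSum (x ∷ xs) = trans (cong (ev x +_) (evSum-odSum xs)) (regroup x (odSum xs) (length xs))
  where
  regroup : ∀ x a b → suc (suc (x + x)) + (a + b) ≡ suc (x + x) + a + suc b
  regroup = solve-∀

odSum-suc : ∀ xs → odSum (map suc xs) ≡ evSum xs + length xs
odSum-suc []       = refl
odSum-suc (x ∷ xs) = trans (cong (od (suc x) +_) (odSum-suc xs)) (regroup x (evSum xs) (length xs))
  where
  regroup : ∀ x a b → suc (suc x + suc x) + (a + b) ≡ suc (suc (x + x)) + a + suc b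
  regroup = solve-∀

-- `od (suc x)` is one more than `ev x`, and the final code 0 is the part 1, which vanishes when
-- lowered. Lowering these odd parts therefore frees `length xs + 1` units.
odSum-suc-0 : ∀ xs → odSum (map suc xs ++ [ 0 ]) ≡ evSum xs + length xs + 1
odSum-suc-0 xs = trans (odSum-++ (map suc xs) [ 0 ]) (cong (_+ 1) (odSum-suc xs))

odSum-zeros : ∀ m → odSum (replicate m 0) ≡ m
odSum-zeros zero    = refl
odSum-zeros (suc m) = cong suc (odSum-zeros m)

-- Enlarging the largest part.

raise : ℕ → List ℕ → List ℕ
raise h []       = []
raise h (x ∷ xs) = x + h ∷ xs

length-raise : ∀ h xs → length (raise h xs) ≡ length xs
length-raise h []       = refl
length-raise h (x ∷ xs) = refl

raise-injective : ∀ h xs ys → raise h xs ≡ raise h ys → xs ≡ ys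
raise-injective h []       []       _  = refl
raise-injective h (x ∷ xs) (y ∷ ys) eq with p , refl ← ∷-injective eq = cong (_∷ ys) (+-cancelʳ-≡ h x y p)

evSum-raise : ∀ h xs → xs ≢ [] → evSum (raise h xs) ≡ evSum xs + (h + h)
evSum-raise h []       ≢[] = ⊥-elim (≢[] refl)
evSum-raise h (x ∷ xs) _   = regroup x h (evSum xs)
  where
  regroup : ∀ x h a → suc (suc (x + h + (x + h))) + a ≡ suc (suc (x + x)) + a + (h + h)
  regroup = solve-∀

odSum-raise : ∀ h xs → xs ≢ [] → odSum (raise h xs) ≡ odSum xs + (h + h)
odSum-raise h []       ≢[] = ⊥-elim (≢[] refl)
odSum-raise h (x ∷ xs) _   = regroup x h (odSum xs)
  where
  regroup : ∀ x h a → suc (x + h + (x + h)) + a ≡ suc (x + x) + a + (h + h)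
  regroup = solve-∀

raise-≥ : ∀ h {xs} → AllPairs _≥_ xs → AllPairs _≥_ (raise h xs)
raise-≥ h []       = []
raise-≥ h (r ∷ rs) = All.map (λ p → ≤-trans p (m≤m+n _ h)) r ∷ rs

raise-> : ∀ h {xs} → AllPairs _>_ xs → AllPairs _>_ (raise h xs)
raise-> h []       = []
raise-> h (r ∷ rs) = All.map (λ p → ≤-trans p (m≤m+n _ h)) r ∷ rs

raise-above : ∀ h {xs} → All (λ x → All (_< x) Z) xs → All (λ x → All (_< x) Z) (raise h xs)
raise-above h []       = []
raise-above h (r ∷ rs) = All.map (λ p → ≤-trans p (m≤m+n _ h)) r ∷ rs

-- The five rules of the injection on codes; raiseEven and raiseOdd are the second
-- one, without and with even parts in the source.  Raising a code by h raises the
-- part by 2h.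
data Image (W O G Z : List ℕ) : Set where
  allOdd :
    length O < 2 ⊎ All (0 <_) O →
    G ≡ W ++ O ++ replicate (length W) 0 → Z ≡ [] → Image W O G Z
  raiseEven : ∀ {z zs h} →
    W ≡ [] → O ≡ map suc (z ∷ zs) ++ [ 0 ] → length G + suc (length Z) ≡ h + h →
    G ≡ [] → Z ≡ raise h (z ∷ zs) → Image W O G Z
  raiseOdd : ∀ {w ws z zs h} →
    W ≡ w ∷ ws → O ≡ map suc (z ∷ zs) ++ [ 0 ] → length G + suc (length Z) ≡ h + h →
    G ≡ raise h (w ∷ ws) → Z ≡ z ∷ zs → Image W O G Z
  keepOdd : ∀ {y z zs h} →
    O ≡ map suc (y ∷ z ∷ zs) ++ [ 0 ] → length G + length Z ≡ h + h →
    G ≡ raise h (W ++ [ suc y ]) → Z ≡ z ∷ zs → Image W O G Z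
  allEven : ∀ {w ws y h} →
    W ≡ w ∷ ws → O ≡ suc y ∷ 0 ∷ [] → length Z ≡ h + h → AllPairs _>_ (ws ++ [ suc y ]) →
    G ≡ [] → Z ≡ suc w ∷ ws ++ [ y ] → Image W O G Z
  repeatedOdd : ∀ {w ws y h} →
    W ≡ w ∷ ws → O ≡ suc y ∷ 0 ∷ [] → length G ≡ h + h → ¬ AllPairs _>_ (ws ++ [ suc y ]) →
    G ≡ raise h (w ∷ ws ++ [ suc y ]) → Z ≡ [] → Image W O G Z

-- Existence of an image of the same weight.

++-[]≢[] : ∀ (xs : List A) {x} → xs ++ [ x ] ≢ []
++-[]≢[] []       ()
++-[]≢[] (_ ∷ _) ()

length-∷ʳ : ∀ (xs : List A) {x} → length (xs ++ [ x ]) ≡ suc (length xs)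
length-∷ʳ xs = trans (length-++ xs) (+-comm (length xs) 1)

data ZeroView : List ℕ → Set where
  positive : ∀ Z → ZeroView (map suc Z)
  zeroLast : ∀ Z → ZeroView (map suc Z ++ [ 0 ])

-- A strictly decreasing list can hold 0 only at its end; this decides whether 1 is a part. The
-- other codes are exhibited as successors because lowering the part `od (suc z)` gives `ev z`.
zeroView : AllPairs _>_ O → ZeroView O
zeroView {[]}         []        = positive []
zeroView {zero ∷ []}  _         = zeroLast []
zeroView {zero ∷ _ ∷ _} ((() ∷ _) ∷ _)
zeroView {suc y ∷ O}  (_ ∷ rs) with zeroView rs
... | positive Z = positive (y ∷ Z)
... | zeroLast Z = zeroLast (y ∷ Z)

Z-decreasing⁻ : ∀ Z → AllPairs _>_ (map suc Z ++ [ 0 ]) → AllPairs _>_ Z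
Z-decreasing⁻ Z p with q , _ ← AllPairs-++⁻ (map suc Z) p = AllPairs.map ≤-pred (AllPairs.map⁻ q)

-- Lowering the odd codes turns the weak bound of `EuOdCode` into the strict one of `OuEdCode`.
below⁻ : ∀ Z {w} → All (_≤ w) (map suc Z ++ [ 0 ]) → All (_< w) Z
below⁻ Z p = All.map⁻ (All.++⁻ˡ (map suc Z) p)

HasImage : List ℕ → List ℕ → Set
HasImage W O = ∃₂ λ G Z → Image W O G Z × OuEdCode G Z × sum (ouEdParts G Z) ≡ sum (euOdParts W O)

-- Splitting `ev w` into `od w` and 1 keeps the code `w` and creates one code 0. The bound `O≤W`
-- keeps `W ++ O` sorted, and the zeros go to the end.
allOdd-image : EuOdCode W O → length O < 2 ⊎ All (0 <_) O → HasImage W O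
allOdd-image {W} {O} c cond =
  W ++ O ++ zs , [] , allOdd cond refl refl , ouEd dec [] (All.universal (λ _ → []) _) , weight
  where
  zs = replicate (length W) 0
  zeros-decreasing : ∀ m → AllPairs _≥_ (replicate m 0)
  zeros-decreasing zero    = []
  zeros-decreasing (suc m) = All.replicate⁺ m z≤n ∷ zeros-decreasing m
  dec : AllPairs _≥_ (W ++ O ++ zs)
  dec = AllPairs.++⁺ (W-decreasing c)
    (AllPairs.++⁺ (AllPairs.map <⇒≤ (O-decreasing c)) (zeros-decreasing (length W))
      (All.universal (λ _ → All.replicate⁺ (length W) z≤n) O))
    (All.map (λ p → All.++⁺ p (All.replicate⁺ (length W) z≤n)) (O≤W c))
  regroup : ∀ a b m → a + (b + m) + 0 ≡ a + m + b
  regroup = solve-∀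
  open ≡-Reasoning
  weight : sum (ouEdParts (W ++ O ++ zs) []) ≡ sum (euOdParts W O)
  weight = begin
    sum (ouEdParts (W ++ O ++ zs) [])   ≡⟨ sum-++ (map od (W ++ O ++ zs)) [] ⟩
    odSum (W ++ O ++ zs) + 0            ≡⟨ cong (_+ 0) (odSum-++ W (O ++ zs)) ⟩
    odSum W + odSum (O ++ zs) + 0       ≡⟨ cong (λ s → odSum W + s + 0) (odSum-++ O zs) ⟩
    odSum W + (odSum O + odSum zs) + 0  ≡⟨ cong (λ s → odSum W + (odSum O + s) + 0) (odSum-zeros (length W)) ⟩
    odSum W + (odSum O + length W) + 0  ≡⟨ regroup (odSum W) (odSum O) (length W) ⟩
    odSum W + length W + odSum O        ≡⟨ cong (_+ odSum O) (evSum-odSum W) ⟨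
    evSum W + odSum O                   ≡⟨ sum-++ (map ev W) (map od O) ⟨
    sum (euOdParts W O)                 ∎

-- Each part, the 1 included, gives up one unit. Their number is even, so returning all units to the
-- largest part preserves its parity and is a shift of its code by `h`.
raiseEven-image : ∀ {z zs h} → EuOdCode [] (map suc (z ∷ zs) ++ [ 0 ]) → suc (length (z ∷ zs)) ≡ h + h →
                  HasImage [] (map suc (z ∷ zs) ++ [ 0 ])
raiseEven-image {z} {zs} {h} c len =
  [] , raise h (z ∷ zs) , raiseEven {h = h} refl refl len refl refl
  , ouEd [] (raise-> h (Z-decreasing⁻ (z ∷ zs) (O-decreasing c))) []
  , weight
  where
  open ≡-Reasoning
  weight : evSum (raise h (z ∷ zs)) ≡ odSum (map suc (z ∷ zs) ++ [ 0 ])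
  weight = begin
    evSum (raise h (z ∷ zs))                ≡⟨ evSum-raise h (z ∷ zs) (λ ()) ⟩
    evSum (z ∷ zs) + (h + h)                ≡⟨ cong (evSum (z ∷ zs) +_) (trans (sym len) (+-comm 1 _)) ⟩
    evSum (z ∷ zs) + (length (z ∷ zs) + 1)  ≡⟨ +-assoc (evSum (z ∷ zs)) _ 1 ⟨
    evSum (z ∷ zs) + length (z ∷ zs) + 1    ≡⟨ odSum-suc-0 (z ∷ zs) ⟨
    odSum (map suc (z ∷ zs) ++ [ 0 ])       ∎

raiseOdd-image : ∀ {w ws z zs h} → EuOdCode (w ∷ ws) (map suc (z ∷ zs) ++ [ 0 ]) →
                 length (w ∷ ws) + suc (length (z ∷ zs)) ≡ h + h →
                 HasImage (w ∷ ws) (map suc (z ∷ zs) ++ [ 0 ])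
raiseOdd-image {w} {ws} {z} {zs} {h} c len =
  raise h Ws , Zs , raiseOdd {h = h} refl refl len refl refl
  , ouEd (raise-≥ h (W-decreasing c)) (Z-decreasing⁻ Zs (O-decreasing c))
      (raise-above h (All.map (below⁻ Zs) (O≤W c)))
  , weight
  where
  Ws = w ∷ ws
  Zs = z ∷ zs
  regroup : ∀ a b m k → a + (m + suc k) + b ≡ a + m + (b + k + 1)
  regroup = solve-∀
  open ≡-Reasoning
  weight : sum (ouEdParts (raise h Ws) Zs) ≡ sum (euOdParts Ws (map suc Zs ++ [ 0 ]))
  weight = begin
    sum (ouEdParts (raise h Ws) Zs)                      ≡⟨ sum-++ (map od (raise h Ws)) (map ev Zs) ⟩
    odSum (raise h Ws) + evSum Zs                        ≡⟨ cong (_+ evSum Zs) (odSum-raise h Ws (λ ())) ⟩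
    odSum Ws + (h + h) + evSum Zs                        ≡⟨ cong (λ s → odSum Ws + s + evSum Zs) len ⟨
    odSum Ws + (length Ws + suc (length Zs)) + evSum Zs  ≡⟨ regroup (odSum Ws) (evSum Zs) (length Ws) (length Zs) ⟩
    odSum Ws + length Ws + (evSum Zs + length Zs + 1)    ≡⟨ cong₂ _+_ (evSum-odSum Ws) (odSum-suc-0 Zs) ⟨
    evSum Ws + odSum (map suc Zs ++ [ 0 ])               ≡⟨ sum-++ (map ev Ws) (map od (map suc Zs ++ [ 0 ])) ⟨
    sum (euOdParts Ws (map suc Zs ++ [ 0 ]))             ∎

∷ʳ-decreasing : ∀ {y} → EuOdCode W (y ∷ O) → AllPairs _≥_ (W ++ [ y ])
∷ʳ-decreasing c = AllPairs.++⁺ (W-decreasing c) ([] ∷ []) (All.map (λ { (p ∷ _) → p ∷ [] }) (O≤W c))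

-- The largest odd part stays as it is, so only m + k - 1 units are freed, an even number when m + k
-- is odd. It may close the list of odd parts because `y` exceeds all of `Zs`.
keepOdd-image : ∀ {y z zs h} → EuOdCode W (map suc (y ∷ z ∷ zs) ++ [ 0 ]) →
                suc (length W) + length (z ∷ zs) ≡ h + h → HasImage W (map suc (y ∷ z ∷ zs) ++ [ 0 ])
keepOdd-image {W} {y} {z} {zs} {h} c len =
  raise h W⁺ , Zs
  , keepOdd {h = h} refl (trans (cong (_+ length Zs) (trans (length-raise h W⁺) (length-∷ʳ W))) len) refl refl
  , ouEd (raise-≥ h (∷ʳ-decreasing c)) (AllPairs.tail yZs-decreasing)
      (raise-above h (All.++⁺ (All.map (λ { (_ ∷ p) → below⁻ Zs p }) (O≤W c))
                              (All.map m<n⇒m<1+n (AllPairs.head yZs-decreasing) ∷ [])))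
  , weight
  where
  Zs = z ∷ zs
  W⁺ = W ++ [ suc y ]
  yZs-decreasing = Z-decreasing⁻ (y ∷ Zs) (O-decreasing c)
  regroup : ∀ a b m k y → a + (y + 0) + (suc m + k) + b ≡ a + m + (y + (b + k + 1))
  regroup = solve-∀
  open ≡-Reasoning
  weight : sum (ouEdParts (raise h W⁺) Zs) ≡ sum (euOdParts W (map suc (y ∷ Zs) ++ [ 0 ]))
  weight = begin
    sum (ouEdParts (raise h W⁺) Zs)
      ≡⟨ sum-++ (map od (raise h W⁺)) (map ev Zs) ⟩
    odSum (raise h W⁺) + evSum Zs
      ≡⟨ cong (_+ evSum Zs) (odSum-raise h W⁺ (++-[]≢[] W)) ⟩
    odSum W⁺ + (h + h) + evSum Zs
      ≡⟨ cong₂ (λ s t → s + t + evSum Zs) (odSum-++ W [ suc y ]) (sym len) ⟩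
    odSum W + (od (suc y) + 0) + (suc (length W) + length Zs) + evSum Zs
      ≡⟨ regroup (odSum W) (evSum Zs) (length W) (length Zs) (od (suc y)) ⟩
    odSum W + length W + (od (suc y) + (evSum Zs + length Zs + 1))
      ≡⟨ cong₂ (λ s t → s + (od (suc y) + t)) (evSum-odSum W) (odSum-suc-0 Zs) ⟨
    evSum W + odSum (map suc (y ∷ Zs) ++ [ 0 ])
      ≡⟨ sum-++ (map ev W) (map od (map suc (y ∷ Zs) ++ [ 0 ])) ⟨
    sum (euOdParts W (map suc (y ∷ Zs) ++ [ 0 ])) ∎

-- Strictness is tested with `suc y`, the code of o₁ as an odd part, because its failure must
-- produce a repeated part in the image of `repeatedOdd`.
allEven-image : ∀ {w ws y h} → EuOdCode (w ∷ ws) (suc y ∷ 0 ∷ []) → suc (length (w ∷ ws)) ≡ h + h →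
                AllPairs _>_ (ws ++ [ suc y ]) → HasImage (w ∷ ws) (suc y ∷ 0 ∷ [])
allEven-image {w} {ws} {y} {h} c len strict =
  [] , Zs , allEven {h = h} refl refl (trans (cong suc (length-∷ʳ ws)) len) strict refl refl
  , ouEd [] decreasing []
  , weight
  where
  Zs = suc w ∷ ws ++ [ y ]
  decreasing : AllPairs _>_ Zs
  decreasing with AllPairs-++⁻ ws strict | O≤W c
  ... | ws> , _ , ws>y | (y<w ∷ _) ∷ _ =
    -- `w` bounds `ws` only weakly; replacing it by `suc w` makes the comparison strict.
    All.++⁺ (All.map s≤s (AllPairs.head (W-decreasing c))) (m<n⇒m<1+n y<w ∷ [])
    ∷ AllPairs.++⁺ ws> ([] ∷ []) (All.map (λ { (p ∷ _) → <⇒≤ p ∷ [] }) ws>y)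
  regroup : ∀ w a y → suc (suc (suc w + suc w)) + (a + (suc (suc (y + y)) + 0))
                      ≡ suc (suc (w + w)) + a + (suc (suc y + suc y) + (1 + 0))
  regroup = solve-∀
  open ≡-Reasoning
  weight : evSum Zs ≡ sum (euOdParts (w ∷ ws) (suc y ∷ 0 ∷ []))
  weight = begin
    ev (suc w) + evSum (ws ++ [ y ])           ≡⟨ cong (ev (suc w) +_) (evSum-++ ws [ y ]) ⟩
    ev (suc w) + (evSum ws + (ev y + 0))       ≡⟨ regroup w (evSum ws) y ⟩
    evSum (w ∷ ws) + odSum (suc y ∷ 0 ∷ [])    ≡⟨ sum-++ (map ev (w ∷ ws)) (map od (suc y ∷ 0 ∷ [])) ⟨
    sum (euOdParts (w ∷ ws) (suc y ∷ 0 ∷ []))  ∎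

repeatedOdd-image : ∀ {w ws y h} → EuOdCode (w ∷ ws) (suc y ∷ 0 ∷ []) → suc (length (w ∷ ws)) ≡ h + h →
                    ¬ AllPairs _>_ (ws ++ [ suc y ]) → HasImage (w ∷ ws) (suc y ∷ 0 ∷ [])
repeatedOdd-image {w} {ws} {y} {h} c len ¬strict =
  raise h W⁺ , [] , repeatedOdd {h = h} refl refl (trans (cong suc (length-∷ʳ ws)) len) ¬strict refl refl
  , ouEd (raise-≥ h (∷ʳ-decreasing c)) [] (All.universal (λ _ → []) _)
  , weight
  where
  Ws = w ∷ ws
  W⁺ = Ws ++ [ suc y ]
  regroup : ∀ a m y → a + (y + 0) + suc m + 0 ≡ a + m + (y + (1 + 0))
  regroup = solve-∀
  open ≡-Reasoning
  weight : sum (ouEdParts (raise h W⁺) []) ≡ sum (euOdParts Ws (suc y ∷ 0 ∷ []))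
  weight = begin
    sum (ouEdParts (raise h W⁺) [])                   ≡⟨ sum-++ (map od (raise h W⁺)) [] ⟩
    odSum (raise h W⁺) + 0                            ≡⟨ cong (_+ 0) (odSum-raise h W⁺ (λ ())) ⟩
    odSum W⁺ + (h + h) + 0                            ≡⟨ cong₂ (λ s t → s + t + 0) (odSum-++ Ws [ suc y ]) (sym len) ⟩
    odSum Ws + (od (suc y) + 0) + suc (length Ws) + 0 ≡⟨ regroup (odSum Ws) (length Ws) (od (suc y)) ⟩
    odSum Ws + length Ws + odSum (suc y ∷ 0 ∷ [])     ≡⟨ cong (_+ odSum (suc y ∷ 0 ∷ [])) (evSum-odSum Ws) ⟨
    evSum Ws + odSum (suc y ∷ 0 ∷ [])                 ≡⟨ sum-++ (map ev Ws) (map od (suc y ∷ 0 ∷ [])) ⟨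
    sum (euOdParts Ws (suc y ∷ 0 ∷ []))               ∎

zeroLast-image : ∀ W z zs → EuOdCode W (map suc (z ∷ zs) ++ [ 0 ]) → HasImage W (map suc (z ∷ zs) ++ [ 0 ])
zeroLast-image W z zs c with half (length W + suc (length (z ∷ zs)))
zeroLast-image []       z zs       c | inj₁ (h , len) = raiseEven-image {h = h} c len
zeroLast-image (w ∷ ws) z zs       c | inj₁ (h , len) = raiseOdd-image {h = h} c len
zeroLast-image W        y (z ∷ zs) c | inj₂ (h , len) =
  keepOdd-image {h = h} c (trans (sym (+-suc _ _)) (suc-injective (trans (sym (+-suc _ _)) len)))
-- Here m + k = 2, which is not odd.
zeroLast-image []       y []       c | inj₂ (h , len) = ⊥-elim (double≢suc-double 1 h len)
zeroLast-image (w ∷ ws) y []       c | inj₂ (h , len)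
  with len′ ← trans (+-comm 1 _) (suc-injective (trans (sym (+-suc (length (w ∷ ws)) 1)) len))
  with allPairs? _>?_ (ws ++ [ suc y ])
... | yes strict = allEven-image {h = h} c len′ strict
... | no ¬strict = repeatedOdd-image {h = h} c len′ ¬strict

image : EuOdCode W O → HasImage W O
image {W} c with zeroView (O-decreasing c)
... | positive Z        = allOdd-image c (inj₂ (All.map⁺ (All.universal (λ _ → s≤s z≤n) Z)))
... | zeroLast []       = allOdd-image c (inj₁ (s≤s (s≤s z≤n)))
... | zeroLast (z ∷ zs) = zeroLast-image W z zs c

-- Injectivity of the rules.

W-positive : EuOdCode W O → All (0 <_) O → 0 < length O → All (0 <_) W
W-positive c []      ()
W-positive c (p ∷ _) _ = All.map (λ { (q ∷ _) → ≤-trans p q }) (O≤W c)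

-- If W′ were shorter, O′ would have at least two more entries than O, all of them
-- positive, and the left side would contain fewer zeros than the right.
allOdd-≮ : EuOdCode W′ O′ → length O′ < 2 ⊎ All (0 <_) O′ →
           W′ ++ O′ ++ replicate (length W′) 0 ≡ W ++ O ++ replicate (length W) 0 →
           ¬ length W′ < length W
allOdd-≮ {W′} {O′} {W} {O} c cond eq W′<W = contradict cond
  where
  m = length W
  m′ = length W′
  d = m ∸ suc m′
  m≡ : m′ + suc d ≡ m
  m≡ = trans (+-suc m′ d) (m+[n∸m]≡n W′<W)
  length-parts : ∀ V P → length (V ++ P ++ replicate (length V) 0) ≡ length V + (length P + length V)
  length-parts V P = trans (length-++ V)
    (cong (length V +_) (trans (length-++ P) (cong (length P +_) (length-replicate (length V)))))
  lengths : m′ + (length O′ + m′) ≡ m + (length O + m)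
  lengths = trans (sym (length-parts W′ O′)) (trans (cong length eq) (length-parts W O))
  regroup : ∀ m′ d k → (m′ + suc d) + (k + (m′ + suc d)) ≡ m′ + (2 + (d + k + d) + m′)
  regroup = solve-∀
  length-O′ : length O′ ≡ 2 + (d + length O + d)
  length-O′ = +-cancelʳ-≡ m′ _ _ (+-cancelˡ-≡ m′ _ _
    (trans lengths (trans (cong (λ m → m + (length O + m)) (sym m≡)) (regroup m′ d (length O)))))
  prefix : W′ ++ O′ ≡ (W ++ O) ++ replicate (suc d) 0
  prefix = ++-cancelʳ (replicate m′ 0) _ _ (begin
    (W′ ++ O′) ++ replicate m′ 0                      ≡⟨ ++-assoc W′ O′ _ ⟩
    W′ ++ O′ ++ replicate m′ 0                        ≡⟨ eq ⟩
    W ++ O ++ replicate m 0                           ≡⟨ ++-assoc W O _ ⟨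
    (W ++ O) ++ replicate m 0
      ≡⟨ cong (λ k → (W ++ O) ++ replicate k 0) (trans (+-comm (suc d) m′) m≡) ⟨
    (W ++ O) ++ replicate (suc d + m′) 0              ≡⟨ cong ((W ++ O) ++_) (replicate-+ (suc d) m′) ⟩
    (W ++ O) ++ replicate (suc d) 0 ++ replicate m′ 0 ≡⟨ ++-assoc (W ++ O) _ _ ⟨
    ((W ++ O) ++ replicate (suc d) 0) ++ replicate m′ 0 ∎)
    where open ≡-Reasoning
  contradict : length O′ < 2 ⊎ All (0 <_) O′ → ⊥
  contradict (inj₁ O′<2) = <⇒≱ O′<2 (subst (2 ≤_) (sym length-O′) (s≤s (s≤s z≤n)))
  contradict (inj₂ O′>0) = n≮n 0 (All.head (All.++⁻ʳ (W ++ O) (subst (All (0 <_)) prefix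
    (All.++⁺ (W-positive c O′>0 (subst (0 <_) (sym length-O′) (s≤s z≤n))) O′>0))))

-- `allOdd-≮`, used in both directions, forces W and W′ to have equal length. Then the cut after W
-- and the number of appended zeros agree.
allOdd-injective : EuOdCode W O → EuOdCode W′ O′ →
                   length O < 2 ⊎ All (0 <_) O → length O′ < 2 ⊎ All (0 <_) O′ →
                   W ++ O ++ replicate (length W) 0 ≡ W′ ++ O′ ++ replicate (length W′) 0 →
                   W ≡ W′ × O ≡ O′
allOdd-injective {W} {O} {W′} {O′} c c′ p p′ eq with <-cmp (length W) (length W′)
... | tri< lt _ _ = ⊥-elim (allOdd-≮ {W = W′} {O′} c p eq lt)
... | tri> _ _ gt = ⊥-elim (allOdd-≮ {W = W} {O} c′ p′ (sym eq) gt)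
... | tri≈ _ same _ with refl , eq′ ← ++-injective-length W {W′} same eq =
  refl , ++-cancelʳ (replicate (length W) 0) O O′ eq′

-- If W is empty, the left side is the strictly decreasing O, while the tail on the right, untouched
-- by `raise`, is not strictly decreasing. If W is nonempty, the left side contains 0, while `suc y`
-- bounds the right side below.
allOdd≢repeatedOdd : ∀ {w ws y} h → EuOdCode W O → EuOdCode (w ∷ ws) (suc y ∷ 0 ∷ []) →
                     ¬ AllPairs _>_ (ws ++ [ suc y ]) →
                     W ++ O ++ replicate (length W) 0 ≢ raise h (w ∷ ws ++ [ suc y ])
allOdd≢repeatedOdd {[]} {O} h c c′ ¬strict eq =
  ¬strict (AllPairs.tail (subst (AllPairs _>_) (trans (sym (++-identityʳ O)) eq) (O-decreasing c)))
allOdd≢repeatedOdd {V@(_ ∷ _)} {O} {w} {ws} {y} h c c′ ¬strict eq =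
  n≮n 0 (All.head (All.++⁻ʳ O (All.++⁻ʳ V (subst (All (0 <_)) (sym eq) positive-parts))))
  where
  positive-parts : All (0 <_) (raise h (w ∷ ws ++ [ suc y ]))
  positive-parts with (p ∷ _) ∷ ps ← O≤W c′ =
    ≤-trans (≤-trans (s≤s z≤n) p) (m≤m+n w h)
    ∷ All.++⁺ (All.map (λ { (q ∷ _) → ≤-trans (s≤s z≤n) q }) ps) (s≤s z≤n ∷ [])

raise-∷ʳ≢[] : ∀ xs {h x} → raise h (xs ++ [ x ]) ≢ []
raise-∷ʳ≢[] []       ()
raise-∷ʳ≢[] (_ ∷ _) ()

parity-clash : ∀ a b h h′ → a + suc b ≡ h + h → a + b ≡ h′ + h′ → ⊥
parity-clash a b h h′ p q =
  double≢suc-double h h′ (trans (sym p) (trans (+-suc a b) (cong suc q)))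

-- The rules measure `h` by the lengths of G and Z, so it can be read off the image: two sources of
-- one image under the same rule were raised equally.
raise-injective₂ : ∀ {n h h′ xs ys zs} → n ≡ h + h → n ≡ h′ + h′ → zs ≡ raise h xs → zs ≡ raise h′ ys → xs ≡ ys
raise-injective₂ {h = h} {h′} {xs} {ys} p q r s
  with refl ← double-injective {h} {h′} (trans (sym p) q) = raise-injective h xs ys (trans (sym r) s)

-- Z is empty exactly for `allOdd` and `repeatedOdd`. Among the other rules, `length G + length Z`
-- is odd for `raiseEven` and `raiseOdd` and even for `keepOdd` and `allEven`; within each pair,
-- emptiness of G decides.
Image-injective : EuOdCode W O → EuOdCode W′ O′ → Image W O G Z → Image W′ O′ G Z → W ≡ W′ × O ≡ O′
Image-injective c c′ (allOdd p g _) (allOdd p′ g′ _) = allOdd-injective c c′ p p′ (trans (sym g) g′)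
Image-injective c c′ (allOdd _ g _) (repeatedOdd {h = h} refl refl _ ¬s g′ _) =
  ⊥-elim (allOdd≢repeatedOdd h c c′ ¬s (trans (sym g) g′))
Image-injective c c′ (repeatedOdd {h = h} refl refl _ ¬s g _) (allOdd _ g′ _) =
  ⊥-elim (allOdd≢repeatedOdd h c′ c ¬s (trans (sym g′) g))
Image-injective c c′ (repeatedOdd {w} {ws} refl refl l _ g _) (repeatedOdd {w′} {ws′} refl refl l′ _ g′ _)
  with refl , refl ← ∷ʳ-injective (w ∷ ws) (w′ ∷ ws′) (raise-injective₂ l l′ g g′) = refl , refl
Image-injective c c′ (raiseEven {z} {zs} refl refl l refl eq) (raiseEven {z′} {zs′} refl refl l′ _ eq′)
  with refl ← raise-injective₂ {xs = z ∷ zs} {z′ ∷ zs′} l l′ eq eq′ = refl , refl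
Image-injective c c′ (raiseOdd {w} {ws} refl refl l g refl) (raiseOdd {w′} {ws′} refl refl l′ g′ refl)
  with refl ← raise-injective₂ {xs = w ∷ ws} {w′ ∷ ws′} l l′ g g′ = refl , refl
Image-injective {W} {W′ = W′} c c′ (keepOdd refl l g refl) (keepOdd refl l′ g′ refl)
  with refl , refl ← ∷ʳ-injective W W′ (raise-injective₂ l l′ g g′) = refl , refl
Image-injective c c′ (allEven {w} {ws} refl refl _ _ _ refl) (allEven {w′} {ws′} refl refl _ _ _ eq)
  with refl ← suc-injective {w} {w′} (∷-injectiveˡ eq)
  with refl , refl ← ∷ʳ-injective ws ws′ (∷-injectiveʳ eq) = refl , refl
Image-injective {G = G} {Z} c c′ (raiseEven {h = h} _ _ l _ _) (keepOdd {h = h′} _ l′ _ _) =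
  ⊥-elim (parity-clash (length G) (length Z) h h′ l l′)
Image-injective {G = G} {Z} c c′ (raiseOdd {h = h} _ _ l _ _) (keepOdd {h = h′} _ l′ _ _) =
  ⊥-elim (parity-clash (length G) (length Z) h h′ l l′)
Image-injective {G = G} {Z} c c′ (keepOdd {h = h′} _ l′ _ _) (raiseEven {h = h} _ _ l _ _) =
  ⊥-elim (parity-clash (length G) (length Z) h h′ l l′)
Image-injective {G = G} {Z} c c′ (keepOdd {h = h′} _ l′ _ _) (raiseOdd {h = h} _ _ l _ _) =
  ⊥-elim (parity-clash (length G) (length Z) h h′ l l′)
Image-injective {Z = Z} c c′ (raiseEven {h = h} _ _ l refl _) (allEven {h = h′} _ _ l′ _ _ _) =
  ⊥-elim (parity-clash 0 (length Z) h h′ l l′)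
Image-injective {Z = Z} c c′ (allEven {h = h′} _ _ l′ _ _ _) (raiseEven {h = h} _ _ l refl _) =
  ⊥-elim (parity-clash 0 (length Z) h h′ l l′)
Image-injective {W} c c′ (keepOdd _ _ g _) (allEven _ _ _ _ refl _) = ⊥-elim (raise-∷ʳ≢[] W (sym g))
Image-injective {W′ = W′} c c′ (allEven _ _ _ _ refl _) (keepOdd _ _ g _) = ⊥-elim (raise-∷ʳ≢[] W′ (sym g))
Image-injective c c′ (raiseEven _ _ _ refl _) (raiseOdd _ _ _ () _)
Image-injective c c′ (raiseOdd _ _ _ () _) (raiseEven _ _ _ refl _)
Image-injective c c′ (raiseOdd _ _ _ () _) (allEven _ _ _ _ refl _)
Image-injective c c′ (allEven _ _ _ _ refl _) (raiseOdd _ _ _ () _)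
Image-injective c c′ (allOdd _ _ refl) (raiseEven _ _ _ _ ())
Image-injective c c′ (allOdd _ _ refl) (raiseOdd _ _ _ _ ())
Image-injective c c′ (allOdd _ _ refl) (keepOdd _ _ _ ())
Image-injective c c′ (allOdd _ _ refl) (allEven _ _ _ _ _ ())
Image-injective c c′ (repeatedOdd _ _ _ _ _ refl) (raiseEven _ _ _ _ ())
Image-injective c c′ (repeatedOdd _ _ _ _ _ refl) (raiseOdd _ _ _ _ ())
Image-injective c c′ (repeatedOdd _ _ _ _ _ refl) (keepOdd _ _ _ ())
Image-injective c c′ (repeatedOdd _ _ _ _ _ refl) (allEven _ _ _ _ _ ())
Image-injective c c′ (raiseEven _ _ _ _ ()) (allOdd _ _ refl)

-- Partitions of the second kind outside the image.

Missed : ℕ → Set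
Missed n = ∃₂ λ G Z → OuEdCode G Z × sum (ouEdParts G Z) ≡ n × (∀ {W O} → EuOdCode W O → ¬ Image W O G Z)

-- Emptiness and parity leave only `keepOdd`. Two parts force h = 1 and W empty, so g = y + 2 with y
-- > i, which makes g at least i + 3.
close-odd-even-missed : ∀ {g i} → g ≤ 2 + i → EuOdCode W O → ¬ Image W O [ g ] [ i ]
close-odd-even-missed _ _ (raiseOdd {h = h} _ _ len _ _) = double≢suc-double h 1 (sym len)
close-odd-even-missed {W = []} {i = i} g≤ c (keepOdd {y} {h = suc zero} refl _ refl refl)
  with (s≤s i<y ∷ _) ∷ _ ← O-decreasing c =
  <⇒≱ i<y (≤-pred (≤-pred (subst (_≤ 2 + i) (+-comm (suc y) 1) g≤)))
close-odd-even-missed {W = []} _ _ (keepOdd {h = suc (suc h)} refl len _ _)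
  with () ← trans len (cong suc (+-suc (suc h) (suc h)))
close-odd-even-missed {W = _ ∷ ws} _ _ (keepOdd _ _ eq _) = ++-[]≢[] ws (sym (∷-injectiveʳ eq))

-- Only `allEven` with `ws` empty has the right shape, and it would give w = y = i although `suc y`
-- is at most `w`.
close-evens-missed : ∀ {i} → EuOdCode W O → ¬ Image W O [] (suc i ∷ i ∷ [])
close-evens-missed _ (raiseEven {h = h} _ _ len _ _) = double≢suc-double h 1 (sym len)
close-evens-missed {W} _ (keepOdd _ _ eq _) = raise-∷ʳ≢[] W (sym eq)
close-evens-missed c (allEven {ws = []} refl refl _ _ _ refl) with (i<i ∷ _) ∷ _ ← O≤W c = n≮n _ i<i
close-evens-missed _ (allEven {ws = _ ∷ ws} _ _ _ _ _ eq) =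
  ++-[]≢[] ws (sym (∷-injectiveʳ (∷-injectiveʳ eq)))

-- Only `raiseOdd` passes the parity test. It raises a head that was already at least the second
-- entry by a positive amount, so the two cannot end up equal.
equal-odds-missed : ∀ {g} → EuOdCode W O → ¬ Image W O (g ∷ g ∷ []) [ 0 ]
equal-odds-missed _ (keepOdd {h = h} _ len _ _) = double≢suc-double h 1 (sym len)
equal-odds-missed c (raiseOdd {w} {h = suc h} refl _ _ eq _)
  with refl ← ∷-injectiveʳ eq | (g≤w ∷ _) ∷ _ ← W-decreasing c =
  <⇒≱ (subst (w <_) (sym (∷-injectiveˡ eq)) (m<m+n w (s≤s z≤n))) g≤w

-- The residue of n modulo 4, found by halving twice, selects the family. The index `i` is j - 1; in
-- clause order the smallest instances are n = 5, 7, 6, 8.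
missed : ∀ r → Missed (5 + r)
missed r with half r
... | inj₁ (h , refl) with half h
...   | inj₁ (i , refl) = [ suc i ] , [ i ]
  , ouEd ([] ∷ []) ([] ∷ []) ((n<1+n i ∷ []) ∷ []) , total i
  , close-odd-even-missed (n≤1+n (suc i))
  where
  total : ∀ i → suc (suc i + suc i) + (suc (suc (i + i)) + 0) ≡ 5 + (i + i + (i + i))
  total = solve-∀
...   | inj₂ (i , refl) = [ suc (suc i) ] , [ i ]
  , ouEd ([] ∷ []) ([] ∷ []) ((m<n⇒m<1+n (n<1+n i) ∷ []) ∷ []) , total i
  , close-odd-even-missed ≤-refl
  where
  total : ∀ i → suc (suc (suc i) + suc (suc i)) + (suc (suc (i + i)) + 0) ≡ 5 + (suc (i + i) + suc (i + i))
  total = solve-∀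
missed r | inj₂ (h , refl) with half h
...   | inj₁ (i , refl) = [] , suc i ∷ i ∷ []
  , ouEd [] ((n<1+n i ∷ []) ∷ [] ∷ []) [] , total i
  , close-evens-missed
  where
  total : ∀ i → suc (suc (suc i + suc i)) + (suc (suc (i + i)) + 0) ≡ 5 + suc (i + i + (i + i))
  total = solve-∀
...   | inj₂ (i , refl) = suc i ∷ suc i ∷ [] , [ 0 ]
  , ouEd ((≤-refl ∷ []) ∷ [] ∷ []) ([] ∷ []) ((s≤s z≤n ∷ []) ∷ (s≤s z≤n ∷ []) ∷ []) , total i
  , equal-odds-missed
  where
  total : ∀ i → suc (suc i + suc i) + (suc (suc i + suc i) + (2 + 0)) ≡ 5 + suc (suc (i + i) + suc (i + i))
  total = solve-∀

-- Transfer from codes to the listed partitions.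

data PartitionImage (xs ys : List ℕ) : Set where
  partitionImage : EuOdCode W O → xs ≡ euOdParts W O → ys ≡ ouEdParts G Z → Image W O G Z → PartitionImage xs ys

PartitionImage-injective : ∀ {xs xs′ ys} → PartitionImage xs ys → PartitionImage xs′ ys → xs ≡ xs′
PartitionImage-injective (partitionImage {G = G} {Z} c refl refl i) (partitionImage {G = G′} {Z′} c′ refl eq i′)
  with refl , refl ← ouEdParts-injective G Z G′ Z′ eq
  with refl , refl ← Image-injective c c′ i i′ = refl

ouEdPartition-∈ : OuEdCode G Z → sum (ouEdParts G Z) ≡ n → ouEdParts G Z ∈ filter ouEd? (partitions n)
ouEdPartition-∈ c sum≡ with isPartition , isOuEd ← ouEd-partition c sum≡ =
  ∈-filter⁺ ouEd? (Equivalence.from (∈-partitions _ _) isPartition) isOuEd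

partition-image : ∀ n {xs} → xs ∈ filter euOd? (partitions n) →
                  ∃[ ys ] ys ∈ filter ouEd? (partitions n) × PartitionImage xs ys
partition-image n xs∈
  with xs∈′ , isEuOd ← ∈-filter⁻ euOd? xs∈
  with W , O , c , refl , sum≡ ← euOd-code (Equivalence.to (∈-partitions n _) xs∈′) isEuOd
  with G , Z , i , d , weight ← image c =
  ouEdParts G Z , ouEdPartition-∈ d (trans weight sum≡) , partitionImage c refl refl i

euOd-unique : ∀ n → Unique (filter euOd? (partitions n))
euOd-unique n = Unique.filter⁺ euOd? (partitions-unique n)

p-eu-od<p-ou-ed : ∀ r → p-eu-od (5 + r) < p-ou-ed (5 + r)
p-eu-od<p-ou-ed r with G , Z , d , sum≡ , not-hit ← missed r =
  length-< PartitionImage-injective (euOd-unique (5 + r)) (partition-image (5 + r)) (ouEdPartition-∈ d sum≡) miss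
  where
  miss : ∀ {xs} → ¬ PartitionImage xs (ouEdParts G Z)
  miss (partitionImage {G = G′} {Z′} c _ eq i) with refl , refl ← ouEdParts-injective G Z G′ Z′ eq = not-hit c i

theorem3p4 : (∀ (n : ℕ) → p-eu-od n ≤ p-ou-ed n) × (∀ (n : ℕ) → n ≥ 5 → p-eu-od n < p-ou-ed n)
theorem3p4 =
    (λ n → length-≤ PartitionImage-injective (euOd-unique n) (partition-image n))
  , (λ n n≥5 → subst (λ n → p-eu-od n < p-ou-ed n) (m+[n∸m]≡n n≥5) (p-eu-od<p-ou-ed (n ∸ 5)))
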